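{- Let $n\ge 1$ be an integer and let $P\in\mathbb Z_{\ge0}[X]$ be a polynomial of degree $n$ with non-negative integer coefficients and $P(0)>0$. Define $h(j)=P(j)$ for $j\ge0$ and $h(j)=0$ for $j<0$. Then $\operatorname{hdepth}(h)\le 2^{n+1}$.
   Context: For a nonzero function $h:\mathbb Z\to\mathbb Z_{\ge 0}$ with $h(j)=0$ for all sufficiently negative $j$, and integers $k\le d$, set $\beta_k^d(h)=\sum_{j\le k}(-1)^{k-j}\binom{d-j}{k-j}h(j)$, and $\operatorname{hdepth}(h)=\max\{d\in\mathbb Z:\ \beta_k^d(h)\ge 0\text{ for all integers }k\le d\}$. -}

module Defs where

open import Data.Nat.Base as ℕ using (ℕ; zero; suc)
open import Data.Nat.Properties as ℕₚ using ()
open import Data.Nat.Combinatorics using (_C_)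
open import Data.Integer.Base as ℤ using (ℤ; +_; -[1+_]; 0ℤ; 1ℤ; -1ℤ; ∣_∣)
open import Data.Integer.Properties as ℤₚ using ()
open import Data.Fin.Base using (toℕ)
open import Data.List.Base using (List; []; _∷_)
open import Data.Product.Base using (∃; _×_; _,_)
open import Relation.Binary.PropositionalEquality.Core using (_≡_; _≢_; refl)
open import Algebra.Properties.Semiring.Sum ℤₚ.+-*-semiring using (sum-syntax)

-- Nonzero functions ℤ → ℤ≥0 that vanish at all sufficiently negative integers.
record HilbertFunction : Set where
  field
    fun      : ℤ → ℕ
    nonzero  : ∃ λ j → fun j ≢ 0
    lower    : ℤ
    vanishes : ∀ j → j ℤ.< lower → fun j ≡ 0

-- The sum over all j ≤ k, truncated to lower ≤ j ≤ k. The omitted terms are all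
-- zero, so the value does not depend on the choice of lower. Only k ≤ d is
-- ever used; then 0 ≤ k - j ≤ d - j for each summand, so the absolute values
-- merely convert these differences to ℕ.
β : (d k : ℤ) → HilbertFunction → ℤ
β d k h = ∑[ i < ∣ 0ℤ ℤ.⊔ (k ℤ.+ 1ℤ ℤ.- lower) ∣ ] term (lower ℤ.+ + toℕ i)
  where
  open HilbertFunction h
  term : ℤ → ℤ
  term j = -1ℤ ℤ.^ ∣ k ℤ.- j ∣ ℤ.* + (∣ d ℤ.- j ∣ C ∣ k ℤ.- j ∣) ℤ.* + fun j

NonNegativeUpTo : HilbertFunction → ℤ → Set
NonNegativeUpTo h d = ∀ k → k ℤ.≤ d → 0ℤ ℤ.≤ β d k h

IsMaximum : (ℤ → Set) → ℤ → Set
IsMaximum S m = S m × (∀ d → S d → d ℤ.≤ m)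

-- "hdepth(h) = m"; such an m is unique by antisymmetry of ≤.
IsHdepth : HilbertFunction → ℤ → Set
IsHdepth h = IsMaximum (NonNegativeUpTo h)

-- Coefficient lists, constant term first; trailing zeros are allowed.
Polynomial : Set
Polynomial = List ℕ

coeff : Polynomial → ℕ → ℕ
coeff []      _       = 0
coeff (a ∷ p) zero    = a
coeff (a ∷ p) (suc i) = coeff p i

HasDegree : Polynomial → ℕ → Set
HasDegree p n = coeff p n ≢ 0 × (∀ i → n ℕ.< i → coeff p i ≡ 0)

eval : Polynomial → ℕ → ℕ
eval []      x = 0
eval (a ∷ p) x = a ℕ.+ x ℕ.* eval p x

extendByZero : (P : Polynomial) → 0 ℕ.< eval P 0 → HilbertFunction
extendByZero P P0>0 = record
  { fun      = h
  ; nonzero  = + 0 , ℕₚ.>⇒≢ P0>0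
  ; lower    = 0ℤ
  ; vanishes = h-vanishes
  }
  where
  h : ℤ → ℕ
  h (+ j)    = eval P j
  h -[1+ _ ] = 0

  h-vanishes : ∀ j → j ℤ.< 0ℤ → h j ≡ 0
  h-vanishes (+ _)    (ℤ.+<+ ())
  h-vanishes -[1+ _ ] _ = refl

{-# OPTIONS --safe #-}

-- Only β₁ and β₂ are needed for the bound. For d ≥ 2, β₁ ≥ 0 says
-- d h(0) ≤ h(1), and substituting this into β₂ ≥ 0, that is
-- (d - 1) h(1) ≤ h(2) + C(d,2) h(0), gives (d - 1) h(1) ≤ 2 h(2).
-- Since h(2) < 2ⁿ h(1), strictly because the constant term is positive,
-- d - 1 < 2ⁿ⁺¹. The maximum exists because d = 0 is admissible and
-- admissibility of a natural number d is decidable.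
module Submission where

open import Defs
open import Data.Nat.Base using (ℕ; zero; suc; z≤n; s≤s; _+_; _*_; _^_; _≤_; _<_; >-nonZero)
open import Data.Nat.Properties
open import Data.Nat.Combinatorics using (_C_; nC1≡n; nCk+nC[k+1]≡[n+1]C[k+1])
import Data.Nat.Tactic.RingSolver as ℕ-Solver
open import Data.Integer.Base as ℤ using (ℤ; +_; -[1+_]; 0ℤ; -1ℤ; 1ℤ; +≤+; -≤+) renaming (_≤_ to _≤ℤ_)
import Data.Integer.Properties as ℤₚ
import Data.Integer.Tactic.RingSolver as ℤ-Solver
open import Data.List.Base using ([]; _∷_)
open import Data.Product.Base using (∃; _×_; _,_; proj₁)
open import Relation.Binary.PropositionalEquality
open import Relation.Nullary using (Dec; yes; no)
open import Relation.Nullary.Decidable using (map′)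
open import Function.Base using (_∘_)

-- Coefficient lists may carry trailing zeros, so a degree bound does not force the remaining tail
-- to be `[]`.
eval-zero : ∀ p x → (∀ i → coeff p i ≡ 0) → eval p x ≡ 0
eval-zero []      x p≡0 = refl
eval-zero (a ∷ p) x p≡0 = begin
  a + x * eval p x  ≡⟨ cong₂ (λ b v → b + x * v) (p≡0 0) (eval-zero p x (p≡0 ∘ suc)) ⟩
  x * 0             ≡⟨ *-zeroʳ x ⟩
  0                 ∎
  where open ≡-Reasoning

collect : ∀ t a v → a * (2 * t) + 2 * (t * v) ≡ (2 * t) * (a + 1 * v)
collect = ℕ-Solver.solve-∀

-- Termwise, the coefficient of index `i ≤ n` is weighted by `2 ^ i ≤ 2 ^ n`. In Horner form,
-- peeling off one coefficient lowers the degree bound by one.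
eval-2≤2^n*eval-1 : ∀ n p → (∀ i → n < i → coeff p i ≡ 0) → eval p 2 ≤ 2 ^ n * eval p 1
eval-2≤2^n*eval-1 n       []      deg = z≤n
eval-2≤2^n*eval-1 zero    (a ∷ p) deg = ≤-reflexive (begin
  a + 2 * eval p 2        ≡⟨ cong (λ v → a + 2 * v) (p≡0 2) ⟩
  a + 0                   ≡⟨ cong (λ v → a + 1 * v) (p≡0 1) ⟨
  a + 1 * eval p 1        ≡⟨ *-identityˡ _ ⟨
  1 * (a + 1 * eval p 1)  ∎)
  where
  open ≡-Reasoning
  p≡0 : ∀ x → eval p x ≡ 0
  p≡0 x = eval-zero p x λ i → deg (suc i) (s≤s z≤n)
eval-2≤2^n*eval-1 (suc n) (a ∷ p) deg = begin
  a + 2 * eval p 2                  ≤⟨ +-mono-≤ (m≤m*n a (2 ^ suc n)) (*-monoʳ-≤ 2 (eval-2≤2^n*eval-1 n p λ i → deg (suc i) ∘ s≤s)) ⟩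
  a * 2 ^ suc n + 2 * (2 ^ n * v)   ≡⟨ collect (2 ^ n) a v ⟩
  2 ^ suc n * (a + 1 * v)           ∎
  where
  open ≤-Reasoning
  v = eval p 1
  instance 2^[1+n]≢0 = m^n≢0 2 (suc n)

-- The constant term alone gives strictness: it is positive, and its weight grows from 1 to
-- `2 ^ n ≥ 2`.
eval-2<2^n*eval-1 : ∀ n p → 1 ≤ n → (∀ i → n < i → coeff p i ≡ 0) → 0 < eval p 0 →
  eval p 2 < 2 ^ n * eval p 1
eval-2<2^n*eval-1 (suc n) (a ∷ p) _ deg p0>0 = begin-strict
  a + 2 * eval p 2                  <⟨ +-mono-<-≤ (m<m*n a (2 ^ suc n) (*-monoʳ-≤ 2 (m^n>0 2 n))) (*-monoʳ-≤ 2 (eval-2≤2^n*eval-1 n p λ i → deg (suc i) ∘ s≤s)) ⟩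
  a * 2 ^ suc n + 2 * (2 ^ n * v)   ≡⟨ collect (2 ^ n) a v ⟩
  2 ^ suc n * (a + 1 * v)           ∎
  where
  open ≤-Reasoning
  v = eval p 1
  instance a≢0 = >-nonZero (subst (0 <_) (+-identityʳ a) p0>0)

-- Induction by Pascal's rule; the factor 2 avoids division.
2*nC2 : ∀ m → 2 * (suc m C 2) ≡ suc m * m
2*nC2 zero    = refl
2*nC2 (suc m) = begin
  2 * (suc (suc m) C 2)          ≡⟨ cong (λ t → 2 * t) (nCk+nC[k+1]≡[n+1]C[k+1] (suc m) 1) ⟨
  2 * (suc m C 1 + suc m C 2)    ≡⟨ cong (λ c → 2 * (c + suc m C 2)) (nC1≡n (suc m)) ⟩
  2 * (suc m + suc m C 2)        ≡⟨ *-distribˡ-+ 2 (suc m) _ ⟩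
  2 * suc m + 2 * (suc m C 2)    ≡⟨ cong (λ t → 2 * suc m + t) (2*nC2 m) ⟩
  2 * suc m + suc m * m          ≡⟨ lemma m ⟩
  suc (suc m) * suc m            ∎
  where
  open ≡-Reasoning
  lemma : ∀ m → 2 * (1 + m) + (1 + m) * m ≡ (2 + m) * (1 + m)
  lemma = ℕ-Solver.solve-∀

module _ (P : Polynomial) (P0>0 : 0 < eval P 0) where
  private
    h = extendByZero P P0>0
    h₀ = + eval P 0
    h₁ = + eval P 1
    h₂ = + eval P 2

  β₁ : ∀ m → β (+ suc m) (+ 1) h ≡ h₁ ℤ.- + suc m ℤ.* h₀
  β₁ m = begin
    -- Since `k` is a literal, the sum unfolds by computation; `m + 0` is left over from `d - 0`.
    -1ℤ ℤ.* + (suc (m + 0) C 1) ℤ.* h₀ ℤ.+ (1ℤ ℤ.* 1ℤ ℤ.* h₁ ℤ.+ 0ℤ)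
      ≡⟨ cong (λ c → -1ℤ ℤ.* + c ℤ.* h₀ ℤ.+ (1ℤ ℤ.* 1ℤ ℤ.* h₁ ℤ.+ 0ℤ)) (trans (nC1≡n _) (+-identityʳ (suc m))) ⟩
    -1ℤ ℤ.* + suc m ℤ.* h₀ ℤ.+ (1ℤ ℤ.* 1ℤ ℤ.* h₁ ℤ.+ 0ℤ)
      ≡⟨ lemma (+ suc m) h₀ h₁ ⟩
    h₁ ℤ.- + suc m ℤ.* h₀ ∎
    where
    open ≡-Reasoning
    lemma : ∀ d x y → -1ℤ ℤ.* d ℤ.* x ℤ.+ (1ℤ ℤ.* 1ℤ ℤ.* y ℤ.+ 0ℤ) ≡ y ℤ.- d ℤ.* x
    lemma = ℤ-Solver.solve-∀

  β₂ : ∀ m → β (+ suc (suc m)) (+ 2) h ≡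
    (h₂ ℤ.+ + (suc (suc m) C 2) ℤ.* h₀) ℤ.- + suc m ℤ.* h₁
  β₂ m = begin
    1ℤ ℤ.* + (suc (suc (m + 0)) C 2) ℤ.* h₀ ℤ.+ (-1ℤ ℤ.* + (suc m C 1) ℤ.* h₁ ℤ.+ (1ℤ ℤ.* 1ℤ ℤ.* h₂ ℤ.+ 0ℤ))
      ≡⟨ cong₂ (λ n c → 1ℤ ℤ.* + (suc (suc n) C 2) ℤ.* h₀ ℤ.+ (-1ℤ ℤ.* + c ℤ.* h₁ ℤ.+ (1ℤ ℤ.* 1ℤ ℤ.* h₂ ℤ.+ 0ℤ)))
           (+-identityʳ m) (nC1≡n (suc m)) ⟩
    1ℤ ℤ.* + (suc (suc m) C 2) ℤ.* h₀ ℤ.+ (-1ℤ ℤ.* + suc m ℤ.* h₁ ℤ.+ (1ℤ ℤ.* 1ℤ ℤ.* h₂ ℤ.+ 0ℤ))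
      ≡⟨ lemma (+ (suc (suc m) C 2)) (+ suc m) h₀ h₁ h₂ ⟩
    (h₂ ℤ.+ + (suc (suc m) C 2) ℤ.* h₀) ℤ.- + suc m ℤ.* h₁ ∎
    where
    open ≡-Reasoning
    lemma : ∀ c e x y z → 1ℤ ℤ.* c ℤ.* x ℤ.+ (-1ℤ ℤ.* e ℤ.* y ℤ.+ (1ℤ ℤ.* 1ℤ ℤ.* z ℤ.+ 0ℤ)) ≡ (z ℤ.+ c ℤ.* x) ℤ.- e ℤ.* y
    lemma = ℤ-Solver.solve-∀

  d*h₀≤h₁ : ∀ m → NonNegativeUpTo h (+ suc m) → suc m * eval P 0 ≤ eval P 1
  d*h₀≤h₁ m β≥0 = ℤₚ.drop‿+≤+ (subst (_≤ℤ h₁) (sym (ℤₚ.pos-* (suc m) (eval P 0)))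
    (ℤₚ.0≤i-j⇒j≤i (subst (0ℤ ≤ℤ_) (β₁ m) (β≥0 (+ 1) (+≤+ (s≤s z≤n))))))

  [d-1]*h₁≤h₂+dC2*h₀ : ∀ m → NonNegativeUpTo h (+ suc (suc m)) →
    suc m * eval P 1 ≤ eval P 2 + (suc (suc m) C 2) * eval P 0
  [d-1]*h₁≤h₂+dC2*h₀ m β≥0 = ℤₚ.drop‿+≤+ (subst₂ _≤ℤ_
    (sym (ℤₚ.pos-* (suc m) (eval P 1)))
    (cong (λ t → h₂ ℤ.+ t) (sym (ℤₚ.pos-* (suc (suc m) C 2) (eval P 0))))
    (ℤₚ.0≤i-j⇒j≤i (subst (0ℤ ≤ℤ_) (β₂ m) (β≥0 (+ 2) (+≤+ (s≤s (s≤s z≤n)))))))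

  -- Here `d` is `suc (suc m)`. Doubling the second inequality turns its binomial term into
  -- `(d - 1) * d * h₀`, which the first bounds by `(d - 1) * h₁`; one of the two copies of
  -- `(d - 1) * h₁` then cancels.
  [d-1]*h₁≤2*h₂ : ∀ m → NonNegativeUpTo h (+ suc (suc m)) → suc m * eval P 1 ≤ 2 * eval P 2
  [d-1]*h₁≤2*h₂ m β≥0 = +-cancelʳ-≤ (suc m * b) _ _ (begin
    suc m * b + suc m * b                  ≡⟨ cong (λ t → suc m * b + t) (+-identityʳ (suc m * b)) ⟨
    2 * (suc m * b)                        ≤⟨ *-monoʳ-≤ 2 ([d-1]*h₁≤h₂+dC2*h₀ m β≥0) ⟩
    2 * (c + (suc (suc m) C 2) * a)        ≡⟨ *-distribˡ-+ 2 c _ ⟩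
    2 * c + 2 * ((suc (suc m) C 2) * a)    ≡⟨ cong (λ t → 2 * c + t) (*-assoc 2 (suc (suc m) C 2) a) ⟨
    2 * c + 2 * (suc (suc m) C 2) * a      ≡⟨ cong (λ t → 2 * c + t * a) (2*nC2 (suc m)) ⟩
    2 * c + suc (suc m) * suc m * a        ≡⟨ cong (λ t → 2 * c + t * a) (*-comm (suc (suc m)) (suc m)) ⟩
    2 * c + suc m * suc (suc m) * a        ≡⟨ cong (λ t → 2 * c + t) (*-assoc (suc m) (suc (suc m)) a) ⟩
    2 * c + suc m * (suc (suc m) * a)      ≤⟨ +-monoʳ-≤ (2 * c) (*-monoʳ-≤ (suc m) (d*h₀≤h₁ (suc m) β≥0)) ⟩
    2 * c + suc m * b                      ∎)
    where
    open ≤-Reasoning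
    a = eval P 0
    b = eval P 1
    c = eval P 2

  nonNegative⇒≤2^[n+1] : ∀ n → 1 ≤ n → (∀ i → n < i → coeff P i ≡ 0) →
    ∀ d → NonNegativeUpTo h d → d ≤ℤ + (2 ^ (n + 1))
  nonNegative⇒≤2^[n+1] n 1≤n deg -[1+ _ ]          β≥0 = -≤+
  nonNegative⇒≤2^[n+1] n 1≤n deg (+ 0)             β≥0 = +≤+ z≤n
  nonNegative⇒≤2^[n+1] n 1≤n deg (+ 1)             β≥0 = +≤+ (m^n>0 2 (n + 1))
  -- Cancelling `eval P 1` leaves `suc m < 2 ^ (n + 1)`, which unfolds to the goal
  -- `suc (suc m) ≤ 2 ^ (n + 1)`: strictness absorbs the gap between `d - 1` and `d`.
  nonNegative⇒≤2^[n+1] n 1≤n deg (+ suc (suc m)) β≥0 = +≤+ (*-cancelʳ-< (eval P 1) _ _ (begin-strict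
    suc m * eval P 1        ≤⟨ [d-1]*h₁≤2*h₂ m β≥0 ⟩
    2 * eval P 2            <⟨ *-monoʳ-< 2 (eval-2<2^n*eval-1 n P 1≤n deg P0>0) ⟩
    2 * (2 ^ n * eval P 1)  ≡⟨ *-assoc 2 (2 ^ n) (eval P 1) ⟨
    2 ^ suc n * eval P 1    ≡⟨ cong (λ e → 2 ^ e * eval P 1) (+-comm 1 n) ⟩
    2 ^ (n + 1) * eval P 1  ∎))
    where open ≤-Reasoning

  β-negative : ∀ d k → β d -[1+ k ] h ≡ 0ℤ
  -- The split lets `-[1+ k ] + 1` compute, to zero here and to a negative number below; either way
  -- the sum is empty.
  β-negative d zero    = refl
  β-negative d (suc k) = refl

  -- The condition ranges over infinitely many `k`, but every negative `k` gives zero, so testing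
  -- `0 ≤ k ≤ d` suffices.
  nonNegativeUpTo? : ∀ d → Dec (NonNegativeUpTo h (+ d))
  nonNegativeUpTo? d = map′ to from (allUpTo? (λ k → 0ℤ ℤₚ.≤? β (+ d) (+ k) h) (suc d))
    where
    to : (∀ {k} → k < suc d → 0ℤ ≤ℤ β (+ d) (+ k) h) → NonNegativeUpTo h (+ d)
    to β≥0 (+ k)    (+≤+ k≤d) = β≥0 (s≤s k≤d)
    to β≥0 -[1+ k ] _         = ℤₚ.≤-reflexive (sym (β-negative (+ d) k))
    from : NonNegativeUpTo h (+ d) → ∀ {k} → k < suc d → 0ℤ ≤ℤ β (+ d) (+ k) h
    from β≥0 (s≤s k≤d) = β≥0 (+ _) (+≤+ k≤d)

  nonNegativeUpTo-0 : NonNegativeUpTo h 0ℤ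
  nonNegativeUpTo-0 (+ 0)    _ = subst (0ℤ ≤ℤ_) (sym (lemma h₀)) (+≤+ z≤n)
    where
    lemma : ∀ x → 1ℤ ℤ.* 1ℤ ℤ.* x ℤ.+ 0ℤ ≡ x
    lemma = ℤ-Solver.solve-∀
  nonNegativeUpTo-0 (+ suc _) (+≤+ ())
  nonNegativeUpTo-0 -[1+ k ] _ = ℤₚ.≤-reflexive (sym (β-negative 0ℤ k))

-- Search downwards from the bound. `S 0ℤ` ends the search at zero, so `S` is never tested at
-- negative integers.
bounded⇒maximum : (S : ℤ → Set) → (∀ d → Dec (S (+ d))) → S 0ℤ →
  ∀ N → (∀ d → S d → d ≤ℤ + N) → ∃ (IsMaximum S)
bounded⇒maximum S S? S0 zero    bound = 0ℤ , S0 , bound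
bounded⇒maximum S S? S0 (suc N) bound with S? (suc N)
... | yes SN = + suc N , SN , bound
-- Excluding `suc N` sharpens the bound to the predecessor of `+ suc N`, which computes to `+ N`.
... | no ¬SN = bounded⇒maximum S S? S0 N λ d Sd →
  ℤₚ.i<j⇒i≤pred[j] (ℤₚ.≤∧≢⇒< (bound d Sd) λ { refl → ¬SN Sd })

theorem3p1 : (n : ℕ) → 1 ≤ n → (P : Polynomial) → HasDegree P n →
    (P0>0 : 0 < eval P 0) →
    ∃ λ d → IsHdepth (extendByZero P P0>0) d × d ≤ℤ + (2 ^ (n + 1))
theorem3p1 n 1≤n P (_ , deg) P0>0
  with bound ← nonNegative⇒≤2^[n+1] P P0>0 n 1≤n deg
  with d , isMax ← bounded⇒maximum _ (nonNegativeUpTo? P P0>0) (nonNegativeUpTo-0 P P0>0) _ bound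
  = d , isMax , bound d (proj₁ isMax)
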